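{- Let $\mathbb T$ be the Fraïssé limit of the class of all finite two-graphs. Then the automorphism group $\mathrm{Aut}(\mathbb T)$ has a dense, locally finite subgroup.
   Context: A two-graph is a 3-uniform hypergraph in which every set of four vertices contains an even number of hyperedges. The class of finite two-graphs is a Fraïssé class; $\mathbb T$ is its Fraïssé limit, the unique countable homogeneous two-graph whose finite substructures are exactly the finite two-graphs. $\mathrm{Aut}(\mathbb T)$ carries the topology of pointwise convergence; a group is locally finite if every finitely generated subgroup is finite. -}

module Defs where

open import Data.Nat using (ℕ)
open import Data.Bool using (Bool; true; false; _xor_)
open import Data.Fin using (Fin)
open import Data.List using (List)
open import Data.List.Membership.Propositional using (_∈_)
open import Data.List.Relation.Unary.Any using (Any)
open import Data.List.Relation.Unary.All using (All)
open import Data.Product using (Σ; _×_; ∃; ∃-syntax)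
open import Relation.Binary.PropositionalEquality using (_≡_; _≢_)
open import Function using (Injective)
import Relation.Binary.PropositionalEquality as P

-- Two-graphs on a carrier V.  A 3-uniform hypergraph is given by a
-- Bool-valued "hyperedge" indicator E on ordered triples which is
-- invariant under permutations and false on triples with a repetition,
-- so that it encodes a set of 3-element subsets of V.

record IsTwoGraph {V : Set} (E : V → V → V → Bool) : Set where
  field
    sym₁₂   : ∀ x y z → E x y z ≡ E y x z
    sym₂₃   : ∀ x y z → E x y z ≡ E x z y
    repeat  : ∀ x z → E x x z ≡ false
    even4   : ∀ a b c d → a ≢ b → a ≢ c → a ≢ d → b ≢ c → b ≢ d → c ≢ d →
              ((E a b c xor E a b d) xor (E a c d xor E b c d)) ≡ false

record FinTwoGraph (n : ℕ) : Set where
  field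
    edge    : Fin n → Fin n → Fin n → Bool
    isTwoGr : IsTwoGraph edge

record CountableTwoGraph : Set where
  field
    E       : ℕ → ℕ → ℕ → Bool
    isTwoGr : IsTwoGraph E

module _ (T : CountableTwoGraph) where
  open CountableTwoGraph T

  record Aut : Set where
    field
      to      : ℕ → ℕ
      from    : ℕ → ℕ
      to-from : ∀ x → to (from x) ≡ x
      from-to : ∀ x → from (to x) ≡ x
      pres    : ∀ x y z → E (to x) (to y) (to z) ≡ E x y z
  open Aut public

  _≈ᴬ_ : Aut → Aut → Set
  g ≈ᴬ h = ∀ x → to g x ≡ to h x

  idᴬ : Aut
  idᴬ = record { to = λ x → x ; from = λ x → x
               ; to-from = λ _ → Relation.Binary.PropositionalEquality.refl
               ; from-to = λ _ → Relation.Binary.PropositionalEquality.refl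
               ; pres = λ _ _ _ → Relation.Binary.PropositionalEquality.refl }

  _∘ᴬ_ : Aut → Aut → Aut
  g ∘ᴬ h = record
    { to = λ x → to g (to h x)
    ; from = λ x → from h (from g x)
    ; to-from = λ x → Relation.Binary.PropositionalEquality.trans
        (Relation.Binary.PropositionalEquality.cong (to g) (to-from h (from g x))) (to-from g x)
    ; from-to = λ x → Relation.Binary.PropositionalEquality.trans
        (Relation.Binary.PropositionalEquality.cong (from h) (from-to g (to h x))) (from-to h x)
    ; pres = λ x y z → Relation.Binary.PropositionalEquality.trans
        (pres g (to h x) (to h y) (to h z)) (pres h x y z) }

  invᴬ : Aut → Aut
  invᴬ g = record
    { to = from g ; from = to g ; to-from = from-to g ; from-to = to-from g
    ; pres = λ x y z → P.trans (P.sym (pres g (from g x) (from g y) (from g z)))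
        (P.trans (P.cong₂ (λ u v → E u v (to g (from g z))) (to-from g x) (to-from g y))
                 (P.cong (E x y) (to-from g z))) }

  record IsSubgroup (H : Aut → Set) : Set where
    field
      resp  : ∀ {g h} → g ≈ᴬ h → H g → H h
      has-id  : H idᴬ
      has-comp : ∀ {g h} → H g → H h → H (g ∘ᴬ h)
      has-inv  : ∀ {g} → H g → H (invᴬ g)

  data Generated (gs : List Aut) : Aut → Set where
    gen  : ∀ {g} → g ∈ gs → Generated gs g
    gid  : Generated gs idᴬ
    gcomp : ∀ {g h} → Generated gs g → Generated gs h → Generated gs (g ∘ᴬ h)
    ginv : ∀ {g} → Generated gs g → Generated gs (invᴬ g)

  FiniteSubgroup : (Aut → Set) → Set
  FiniteSubgroup K = ∃[ L ] (∀ g → K g → Any (λ h → g ≈ᴬ h) L)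

  LocallyFinite : (Aut → Set) → Set
  LocallyFinite H = ∀ (gs : List Aut) → All H gs → FiniteSubgroup (Generated gs)

  -- dense in the topology of pointwise convergence: every basic open
  -- neighbourhood {h | h agrees with g on a finite tuple a} of every
  -- automorphism g meets H
  Dense : (Aut → Set) → Set
  Dense H = ∀ (g : Aut) (n : ℕ) (a : Fin n → ℕ) →
            ∃[ h ] (H h × (∀ i → to h (a i) ≡ to g (a i)))

  -- T is the Fraïssé limit of finite two-graphs:
  -- (i) every finite two-graph embeds into T (finite substructures of T
  --     are two-graphs automatically, since T is one), and
  -- (ii) T is homogeneous: every isomorphism between finite
  --     substructures extends to an automorphism.
  Universal : Set
  Universal = ∀ (n : ℕ) (G : FinTwoGraph n) →
    ∃[ f ] (Injective _≡_ _≡_ f ×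
            (∀ i j k → E (f i) (f j) (f k) ≡ FinTwoGraph.edge G i j k))

  Homogeneous : Set
  Homogeneous = ∀ (n : ℕ) (a b : Fin n → ℕ) →
    Injective _≡_ _≡_ a → Injective _≡_ _≡_ b →
    (∀ i j k → E (a i) (a j) (a k) ≡ E (b i) (b j) (b k)) →
    ∃[ g ] (∀ i → to g (a i) ≡ b i)

  IsFraisseLimit : Set
  IsFraisseLimit = Universal × Homogeneous

{-
Let A be a finite two-graph with hyperedges R.  Its cover has as vertices the
pairs (x , w) with x ∈ A and w : A → ℤ/2, and hyperedges R(x,y,z) + δk, where
k((x , w), (y , w′)) = w(y) + w′(x).  The vertices (x , 0) form a copy of A.

 * Aut(A) acts on the cover by (x , w) ↦ (αx , w ∘ α⁻¹): a group homomorphism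
   extending the action on A.
 * Every partial automorphism of A extends to an automorphism of the cover, of
   the form (x , w) ↦ (πx , (w + f x) ∘ π⁻¹).
 * Every one-point extension of a nonempty A embeds in the cover over A.

By the last point and homogeneity, 𝕋 is the union of a chain of finite
two-graphs each of which is the cover of the previous one.  The first point makes
the automorphism groups along the chain a directed system of finite groups whose
limit acts on 𝕋, and by the second point this locally finite limit is dense.
-}
module Submission where

open import Defs
open import Data.Bool using (Bool; true; false; not; _xor_)
open import Data.Bool.Properties using (xor-comm; xor-identityʳ; xor-same)
  renaming (_≟_ to _≟ᵇ_)
open import Data.Bool.Solver using (module xor-∧-Solver)
open import Data.Empty using (⊥-elim)
open import Data.Fin using (Fin; zero; suc; combine; remQuot; finToFun; funToFin; _<?_)
open import Data.Fin.Permutation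
  using (Permutation′; permutation; _⟨$⟩ʳ_; _⟨$⟩ˡ_; inverseˡ; inverseʳ; flip; _∘ₚ_; transpose)
  renaming (id to idₚ)
open import Data.Fin.Properties
  using (_≟_; any?; all?; <-cmp; remQuot-combine; combine-remQuot
        ; finToFun-funToFin; funToFin-finToFin; 2↔Bool)
open import Data.List using (List; []; _∷_; map; allFin; cartesianProductWith)
open import Data.List.Membership.Propositional using (lose)
open import Data.List.Membership.Propositional.Properties
  using (∈-allFin; ∈-cartesianProductWith⁺)
open import Data.List.Relation.Unary.All as All using (All; []; _∷_)
open import Data.List.Relation.Unary.Any as Any using (Any)
open import Data.List.Relation.Unary.Any.Properties using (map⁺)
open import Data.Nat using (ℕ; zero; suc; _+_; _*_; _^_; _≤_; _<_; _⊔_)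
open import Data.Nat.Properties as ℕₚ using (≤-refl; ≤-trans)
open import Data.Product using (_×_; ∃-syntax; _,_; proj₁; proj₂)
open import Data.Sum using (inj₁; inj₂)
open import Function using (Injective; Inverse; _∘_)
open import Relation.Binary.Definitions using (tri<; tri≈; tri>)
open import Relation.Binary.PropositionalEquality
open import Relation.Nullary using (Dec; yes; no; ¬_)
open import Relation.Nullary.Decidable using (_×-dec_)

open xor-∧-Solver using (solve; _:+_; _:=_; con)
open ≡-Reasoning

-- Two-graphs as 2-cocycles over ℤ/2

TripleMap : Set → Set
TripleMap V = V → V → V → Bool

-- The even-quadruple condition, with a triple allowed to degenerate, says that
-- a triple map is a 2-cocycle over ℤ/2.
record IsCocycle {V : Set} (R : TripleMap V) : Set where
  field
    swap₁₂  : ∀ x y z → R x y z ≡ R y x z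
    swap₂₃  : ∀ x y z → R x y z ≡ R x z y
    repeat  : ∀ x z → R x x z ≡ false
    cocycle : ∀ d x y z → R x y z ≡ (R d x y xor (R d x z xor R d y z))

  repeat₂₃ : ∀ x z → R z x x ≡ false
  repeat₂₃ x z = trans (swap₁₂ z x x) (trans (swap₂₃ x z x) (repeat x z))

  repeat₁₃ : ∀ x z → R x z x ≡ false
  repeat₁₃ x z = trans (swap₂₃ x z x) (repeat x z)

open IsCocycle

cong₃ : {A B : Set} (f : A → A → A → B) {x x′ y y′ z z′ : A} →
        x ≡ x′ → y ≡ y′ → z ≡ z′ → f x y z ≡ f x′ y′ z′
cong₃ f refl refl refl = refl

pullback-isCocycle : {V W : Set} {R : TripleMap V} (h : W → V) → IsCocycle R →
                     IsCocycle (λ x y z → R (h x) (h y) (h z))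
pullback-isCocycle h c = record
  { swap₁₂  = λ x y z → swap₁₂ c (h x) (h y) (h z)
  ; swap₂₃  = λ x y z → swap₂₃ c (h x) (h y) (h z)
  ; repeat  = λ x z → repeat c (h x) (h z)
  ; cocycle = λ d x y z → cocycle c (h d) (h x) (h y) (h z)
  }

-- The coboundary of a 1-cochain. For the adjacency function of a graph it marks the triples
-- spanning an odd number of edges, the usual two-graph of that graph.
δ : {V : Set} → (V → V → Bool) → TripleMap V
δ k x y z = k x y xor (k x z xor k y z)

-- In the cocycle identity each pair through `d` lies in two of the three triples on the right and
-- cancels; the pairs among `x`, `y`, `z` remain.
δ-isCocycle : {V : Set} {k : V → V → Bool} →
              (∀ x y → k x y ≡ k y x) → (∀ x → k x x ≡ false) → IsCocycle (δ k)
δ-isCocycle {k = k} k-sym k-irrefl = record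
  { swap₁₂  = λ x y z → trans
      (cong (_xor (k x z xor k y z)) (k-sym x y))
      (solve 3 (λ a b c → a :+ (b :+ c) := a :+ (c :+ b)) refl (k y x) (k x z) (k y z))
  ; swap₂₃  = λ x y z → trans
      (cong (λ u → k x y xor (k x z xor u)) (k-sym y z))
      (solve 3 (λ a b c → a :+ (b :+ c) := b :+ (a :+ c)) refl (k x y) (k x z) (k z y))
  ; repeat  = λ x z → trans
      (cong (_xor (k x z xor k x z)) (k-irrefl x))
      (solve 1 (λ a → con false :+ (a :+ a) := con false) refl (k x z))
  ; cocycle = λ d x y z →
      solve 6 (λ xy xz yz dx dy dz →
          xy :+ (xz :+ yz) :=
          (dx :+ (dy :+ xy)) :+ ((dx :+ (dz :+ xz)) :+ (dy :+ (dz :+ yz))))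
        refl (k x y) (k x z) (k y z) (k d x) (k d y) (k d z)
  }

xor-isCocycle : {V : Set} {R S : TripleMap V} → IsCocycle R → IsCocycle S →
                IsCocycle (λ x y z → R x y z xor S x y z)
xor-isCocycle {R = R} {S} c c′ = record
  { swap₁₂  = λ x y z → cong₂ _xor_ (swap₁₂ c x y z) (swap₁₂ c′ x y z)
  ; swap₂₃  = λ x y z → cong₂ _xor_ (swap₂₃ c x y z) (swap₂₃ c′ x y z)
  ; repeat  = λ x z → cong₂ _xor_ (repeat c x z) (repeat c′ x z)
  ; cocycle = λ d x y z → trans
      (cong₂ _xor_ (cocycle c d x y z) (cocycle c′ d x y z))
      (solve 6 (λ a b e a′ b′ e′ →
          (a :+ (b :+ e)) :+ (a′ :+ (b′ :+ e′)) :=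
          (a :+ a′) :+ ((b :+ b′) :+ (e :+ e′)))
        refl (R d x y) (R d x z) (R d y z) (S d x y) (S d x z) (S d y z))
  }

isCocycle⇒isTwoGraph : {V : Set} {R : TripleMap V} → IsCocycle R → IsTwoGraph R
isCocycle⇒isTwoGraph {R = R} c = record
  { sym₁₂  = swap₁₂ c
  ; sym₂₃  = swap₂₃ c
  ; repeat = repeat c
  ; even4  = λ x y z w _ _ _ _ _ _ → trans
      (cong (λ u → (R x y z xor R x y w) xor (R x z w xor u)) (cocycle c x y z w))
      (solve 3 (λ a b e → (a :+ b) :+ (e :+ (a :+ (b :+ e))) := con false)
        refl (R x y z) (R x y w) (R x z w))
  }

module _ {R : TripleMap ℕ} (tg : IsTwoGraph R) where
  open IsTwoGraph tg renaming (repeat to rep)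
  private
    rep₂₃ : ∀ x z → R z x x ≡ false
    rep₂₃ x z = trans (sym₁₂ z x x) (trans (sym₂₃ x z x) (rep x z))

    rep₁₃ : ∀ x z → R x z x ≡ false
    rep₁₃ x z = trans (sym₂₃ x z x) (rep x z)

    -- The axiom speaks of four distinct points only. When two coincide, symmetry and vanishing on
    -- repetitions settle the identity; otherwise it is the axiom solved for `R x y z`.
    quadruple : ∀ d x y z → R x y z ≡ (R d x y xor (R d x z xor R d y z))
    quadruple d x y z with d ℕₚ.≟ x | d ℕₚ.≟ y | d ℕₚ.≟ z | x ℕₚ.≟ y | x ℕₚ.≟ z | y ℕₚ.≟ z
    ... | yes refl | _ | _ | _ | _ | _ rewrite rep d y | rep d z = refl
    ... | _ | yes refl | _ | _ | _ | _
      rewrite rep₁₃ d x | rep d z | sym₁₂ x d z =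
        solve 1 (λ a → a := con false :+ (a :+ con false)) refl (R d x z)
    ... | _ | _ | yes refl | _ | _ | _
      rewrite rep₁₃ d x | rep₁₃ d y | sym₂₃ x y d | sym₁₂ x d y =
        solve 1 (λ a → a := a :+ (con false :+ con false)) refl (R d x y)
    ... | _ | _ | _ | yes refl | _ | _ rewrite rep x z | rep₂₃ x d =
        solve 1 (λ a → con false := con false :+ (a :+ a)) refl (R d x z)
    ... | _ | _ | _ | _ | yes refl | _ rewrite rep₁₃ x y | rep₂₃ x d | sym₂₃ d y x =
        solve 1 (λ a → con false := a :+ (con false :+ a)) refl (R d x y)
    ... | _ | _ | _ | _ | _ | yes refl rewrite rep₂₃ y x | rep₂₃ y d =
        solve 1 (λ a → con false := a :+ (a :+ con false)) refl (R d x y)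
    ... | no d≢x | no d≢y | no d≢z | no x≢y | no x≢z | no y≢z = begin
      s
        ≡⟨ solve 4 (λ p q r s → s := ((p :+ q) :+ (r :+ s)) :+ (p :+ (q :+ r))) refl p q r s ⟩
      ((p xor q) xor (r xor s)) xor t
        ≡⟨ cong (_xor t) (even4 d x y z d≢x d≢y d≢z x≢y x≢z y≢z) ⟩
      t ∎
      where
      p = R d x y
      q = R d x z
      r = R d y z
      s = R x y z
      t = p xor (q xor r)

  isTwoGraph⇒isCocycle : IsCocycle R
  isTwoGraph⇒isCocycle = record
    { swap₁₂ = sym₁₂ ; swap₂₃ = sym₂₃ ; repeat = rep ; cocycle = quadruple }

-- The cover of a finite two-graph

-- Vertices of the cover of an n-vertex two-graph: pairs of a vertex (shape)
-- and a ℤ/2-valued function (phase), coded in Fin.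

coverSize : ℕ → ℕ
coverSize n = n * 2 ^ n

bit : Fin 2 → Bool
bit = Inverse.to 2↔Bool

unbit : Bool → Fin 2
unbit = Inverse.from 2↔Bool

unbit-bit : ∀ i → unbit (bit i) ≡ i
unbit-bit i = Inverse.inverseʳ 2↔Bool refl

bit-unbit : ∀ b → bit (unbit b) ≡ b
bit-unbit b = Inverse.inverseˡ 2↔Bool refl

funToFin-cong : ∀ {m n} {f g : Fin m → Fin n} → (∀ i → f i ≡ g i) →
                funToFin f ≡ funToFin g
funToFin-cong {zero}  eq = refl
funToFin-cong {suc m} eq = cong₂ combine (eq zero) (funToFin-cong (eq ∘ suc))

module _ {n : ℕ} where

  shape : Fin (coverSize n) → Fin n
  shape p = proj₁ (remQuot {n} (2 ^ n) p)

  phase : Fin (coverSize n) → Fin n → Bool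
  phase p y = bit (finToFun (proj₂ (remQuot {n} (2 ^ n) p)) y)

  vertex : Fin n → (Fin n → Bool) → Fin (coverSize n)
  vertex x w = combine x (funToFin (unbit ∘ w))

  shape-vertex : ∀ x w → shape (vertex x w) ≡ x
  shape-vertex x w = cong proj₁ (remQuot-combine {n} x (funToFin (unbit ∘ w)))

  phase-vertex : ∀ x w y → phase (vertex x w) y ≡ w y
  phase-vertex x w y = begin
    phase (vertex x w) y
      ≡⟨ cong (λ r → bit (finToFun (proj₂ r) y)) (remQuot-combine {n} x (funToFin (unbit ∘ w))) ⟩
    bit (finToFun (funToFin (unbit ∘ w)) y)
      ≡⟨ cong bit (finToFun-funToFin (unbit ∘ w) y) ⟩
    bit (unbit (w y))
      ≡⟨ bit-unbit (w y) ⟩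
    w y ∎

  vertex-shape-phase : ∀ p → vertex (shape p) (phase p) ≡ p
  vertex-shape-phase p = begin
    vertex (shape p) (phase p)
      ≡⟨ cong (combine (shape p)) (funToFin-cong {n} (λ y → unbit-bit (finToFun r y))) ⟩
    combine (shape p) (funToFin (finToFun {2} {n} r))
      ≡⟨ cong (combine (shape p)) (funToFin-finToFin {n} {2} r) ⟩
    combine (shape p) r
      ≡⟨ combine-remQuot {n} (2 ^ n) p ⟩
    p ∎
    where r = proj₂ (remQuot {n} (2 ^ n) p)

  vertex-cong : ∀ {x x′ w w′} → x ≡ x′ → (∀ y → w y ≡ w′ y) → vertex x w ≡ vertex x′ w′
  vertex-cong x≡x′ w≗w′ = cong₂ combine x≡x′ (funToFin-cong (cong unbit ∘ w≗w′))

  vertex-unique : ∀ {x w} p → x ≡ shape p → (∀ y → w y ≡ phase p y) → vertex x w ≡ p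
  vertex-unique p eqₛ eqₚ = trans (vertex-cong eqₛ eqₚ) (vertex-shape-phase p)

  ι : Fin n → Fin (coverSize n)
  ι x = vertex x (λ _ → false)

  ι-injective : Injective _≡_ _≡_ ι
  ι-injective {x} {y} eq =
    trans (sym (shape-vertex x _)) (trans (cong shape eq) (shape-vertex y _))

  phaseSum : Fin (coverSize n) → Fin (coverSize n) → Bool
  phaseSum p q = phase p (shape q) xor phase q (shape p)

  coverEdge : TripleMap (Fin n) → TripleMap (Fin (coverSize n))
  coverEdge R p q r = R (shape p) (shape q) (shape r) xor δ phaseSum p q r

  phaseSum-sym : ∀ p q → phaseSum p q ≡ phaseSum q p
  phaseSum-sym p q = xor-comm (phase p (shape q)) (phase q (shape p))

  phaseSum-irrefl : ∀ p → phaseSum p p ≡ false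
  phaseSum-irrefl p = solve 1 (λ a → a :+ a := con false) refl (phase p (shape p))

  coverEdge-isCocycle : ∀ {R} → IsCocycle R → IsCocycle (coverEdge R)
  coverEdge-isCocycle c =
    xor-isCocycle (pullback-isCocycle shape c) (δ-isCocycle phaseSum-sym phaseSum-irrefl)

  phaseSum-vertex : ∀ x w y w′ → phaseSum (vertex x w) (vertex y w′) ≡ w y xor w′ x
  phaseSum-vertex x w y w′ = cong₂ _xor_
    (trans (phase-vertex x w _) (cong w (shape-vertex y w′)))
    (trans (phase-vertex y w′ _) (cong w′ (shape-vertex x w)))

  coverEdge-vertex : ∀ R x w y w′ z w″ →
    coverEdge R (vertex x w) (vertex y w′) (vertex z w″) ≡
    R x y z xor ((w y xor w′ x) xor ((w z xor w″ x) xor (w′ z xor w″ y)))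
  coverEdge-vertex R x w y w′ z w″ = cong₂ _xor_
    (cong₃ R (shape-vertex x w) (shape-vertex y w′) (shape-vertex z w″))
    (cong₂ _xor_ (phaseSum-vertex x w y w′)
      (cong₂ _xor_ (phaseSum-vertex x w z w″) (phaseSum-vertex y w′ z w″)))

  coverEdge-ι : ∀ R x y z → coverEdge R (ι x) (ι y) (ι z) ≡ R x y z
  coverEdge-ι R x y z = trans (coverEdge-vertex R x _ y _ z _)
    (solve 1 (λ a → a :+ con false := a) refl (R x y z))

  -- Permutations of the cover over permutations of the base

  twist : Permutation′ n → (Fin n → Fin n → Bool) → Permutation′ (coverSize n)
  twist π f = permutation fwd bwd fwd-bwd bwd-fwd
    where
    fwd bwd : Fin (coverSize n) → Fin (coverSize n)
    fwd p = vertex (π ⟨$⟩ʳ shape p) (λ y → phase p (π ⟨$⟩ˡ y) xor f (shape p) (π ⟨$⟩ˡ y))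
    -- The row of `f` to remove is indexed by the shape of the preimage, hence `π ⟨$⟩ˡ shape p`;
    -- over ℤ/2 removing it means adding it again.
    bwd p = vertex (π ⟨$⟩ˡ shape p) (λ y → phase p (π ⟨$⟩ʳ y) xor f (π ⟨$⟩ˡ shape p) y)

    cancel : ∀ {w w′ a b} → w ≡ w′ xor a → a ≡ b → w xor b ≡ w′
    cancel {w′ = w′} {a} refl refl = solve 2 (λ w a → (w :+ a) :+ a := w) refl w′ a

    fwd-bwd : ∀ p → fwd (bwd p) ≡ p
    fwd-bwd p = vertex-unique p
      (trans (cong (π ⟨$⟩ʳ_) (shape-vertex _ _)) (inverseʳ π))
      (λ y → cancel
        (trans (phase-vertex _ _ _)
          (cong (λ u → phase p u xor f (π ⟨$⟩ˡ shape p) (π ⟨$⟩ˡ y)) (inverseʳ π)))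
        (cong (λ u → f u (π ⟨$⟩ˡ y)) (sym (shape-vertex _ _))))

    bwd-fwd : ∀ p → bwd (fwd p) ≡ p
    bwd-fwd p = vertex-unique p shape-eq
      (λ y → cancel
        (trans (phase-vertex _ _ _) (cong (λ u → phase p u xor f (shape p) u) (inverseˡ π)))
        (cong (λ u → f u y) (sym shape-eq)))
      where
      shape-eq : π ⟨$⟩ˡ shape (fwd p) ≡ shape p
      shape-eq = trans (cong (π ⟨$⟩ˡ_) (shape-vertex _ _)) (inverseˡ π)

  -- Images have shapes moved by `π` and phases precomposed with its inverse, so each phase is read
  -- at the original shape; only the two rows of `f` contribute anything new.
  phaseSum-twist : ∀ π f p q →
    phaseSum (twist π f ⟨$⟩ʳ p) (twist π f ⟨$⟩ʳ q) ≡
    phaseSum p q xor (f (shape p) (shape q) xor f (shape q) (shape p))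
  phaseSum-twist π f p q = trans
    (phaseSum-vertex _ _ _ _)
    (trans
      (cong₂ (λ u v → (phase p u xor f (shape p) u) xor (phase q v xor f (shape q) v))
        (inverseˡ π) (inverseˡ π))
      (solve 4 (λ a b a′ b′ → (a :+ b) :+ (a′ :+ b′) := (a :+ a′) :+ (b :+ b′))
        refl (phase p (shape q)) _ (phase q (shape p)) _))

  -- By hypothesis `π` changes the hyperedges by the coboundary of the symmetrised `f`. The twist
  -- changes `δ phaseSum` by the same coboundary, and the two cancel.
  twist-preserves : ∀ R π f →
    (∀ x y z → R (π ⟨$⟩ʳ x) (π ⟨$⟩ʳ y) (π ⟨$⟩ʳ z) ≡
               R x y z xor δ (λ u v → f u v xor f v u) x y z) →
    ∀ p q r → coverEdge R (twist π f ⟨$⟩ʳ p) (twist π f ⟨$⟩ʳ q) (twist π f ⟨$⟩ʳ r) ≡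
              coverEdge R p q r
  twist-preserves R π f hyp p q r = trans
    (cong₂ _xor_
      (trans (cong₃ R (shape-vertex _ _) (shape-vertex _ _) (shape-vertex _ _)) (hyp x y z))
      (cong₂ _xor_ (phaseSum-twist π f p q)
        (cong₂ _xor_ (phaseSum-twist π f p r) (phaseSum-twist π f q r))))
    (solve 7 (λ a k l m k′ l′ m′ →
        (a :+ (k′ :+ (l′ :+ m′))) :+ ((k :+ k′) :+ ((l :+ l′) :+ (m :+ m′))) :=
        a :+ (k :+ (l :+ m)))
      refl (R x y z) (phaseSum p q) (phaseSum p r) (phaseSum q r) (F x y) (F x z) (F y z))
    where
    x = shape p
    y = shape q
    z = shape r
    F : Fin n → Fin n → Bool
    F u v = f u v xor f v u

  -- The twist adds only the row `f x` to the zero phase of `ι x`, so a vanishing row keeps the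
  -- image in the zero-phase copy.
  twist-ι : ∀ π f x → (∀ y → f x y ≡ false) → twist π f ⟨$⟩ʳ ι x ≡ ι (π ⟨$⟩ʳ x)
  twist-ι π f x f≡0 = vertex-cong
    (cong (π ⟨$⟩ʳ_) (shape-vertex x _))
    (λ y → cong₂ _xor_ (phase-vertex x _ _)
      (trans (cong (λ u → f u (π ⟨$⟩ˡ y)) (shape-vertex x _)) (f≡0 (π ⟨$⟩ˡ y))))

-- Automorphisms and their lifts to the cover

record Symmetry {n} (R : TripleMap (Fin n)) : Set where
  field
    perm      : Permutation′ n
    preserves : ∀ x y z → R (perm ⟨$⟩ʳ x) (perm ⟨$⟩ʳ y) (perm ⟨$⟩ʳ z) ≡ R x y z

open Symmetry

infix 4 _≈ˢ_

_≈ˢ_ : ∀ {n} {R : TripleMap (Fin n)} → Symmetry R → Symmetry R → Set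
α ≈ˢ β = ∀ x → perm α ⟨$⟩ʳ x ≡ perm β ⟨$⟩ʳ x

⟨$⟩ˡ-cong : ∀ {n} (π ρ : Permutation′ n) → (∀ x → π ⟨$⟩ʳ x ≡ ρ ⟨$⟩ʳ x) →
            ∀ x → π ⟨$⟩ˡ x ≡ ρ ⟨$⟩ˡ x
⟨$⟩ˡ-cong π ρ eq x = begin
  π ⟨$⟩ˡ x                        ≡⟨ cong (π ⟨$⟩ˡ_) (inverseʳ ρ) ⟨
  π ⟨$⟩ˡ (ρ ⟨$⟩ʳ (ρ ⟨$⟩ˡ x))      ≡⟨ cong (π ⟨$⟩ˡ_) (eq (ρ ⟨$⟩ˡ x)) ⟨
  π ⟨$⟩ˡ (π ⟨$⟩ʳ (ρ ⟨$⟩ˡ x))      ≡⟨ inverseˡ π ⟩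
  ρ ⟨$⟩ˡ x                        ∎

module _ {n} {R : TripleMap (Fin n)} where

  idˢ : Symmetry R
  idˢ = record { perm = idₚ ; preserves = λ _ _ _ → refl }

  infixr 9 _∘ˢ_

  _∘ˢ_ : Symmetry R → Symmetry R → Symmetry R
  α ∘ˢ β = record
    { perm      = perm β ∘ₚ perm α
    ; preserves = λ x y z → trans (preserves α _ _ _) (preserves β x y z)
    }

  invˢ : Symmetry R → Symmetry R
  invˢ α = record
    { perm      = flip (perm α)
    ; preserves = λ x y z → trans (sym (preserves α _ _ _))
        (cong₃ R (inverseʳ (perm α)) (inverseʳ (perm α)) (inverseʳ (perm α)))
    }

  invˢ-cong : {α β : Symmetry R} → α ≈ˢ β → invˢ α ≈ˢ invˢ β
  invˢ-cong {α} {β} = ⟨$⟩ˡ-cong (perm α) (perm β)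

module _ {n} {R : TripleMap (Fin n)} where

  lift : Symmetry R → Symmetry (coverEdge R)
  lift α = record
    { perm      = twist (perm α) (λ _ _ → false)
    ; preserves = twist-preserves R (perm α) _
        (λ x y z → trans (preserves α x y z)
          (solve 1 (λ a → a := a :+ con false) refl (R x y z)))
    }

  lift-ι : ∀ α x → perm (lift α) ⟨$⟩ʳ ι x ≡ ι (perm α ⟨$⟩ʳ x)
  lift-ι α x = twist-ι (perm α) _ x (λ _ → refl)

  lift-cong : {α β : Symmetry R} → α ≈ˢ β → lift α ≈ˢ lift β
  lift-cong {α} {β} eq p = vertex-cong (eq (shape p))
    (λ y → cong (λ u → phase p u xor false) (⟨$⟩ˡ-cong (perm α) (perm β) eq y))

  lift-id : lift idˢ ≈ˢ idˢ
  lift-id p = vertex-unique {n} p refl (λ y → xor-identityʳ (phase {n} p y))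

  -- Without an added row a phase is only relabelled along the permutation, and relabellings
  -- compose.
  lift-∘ : ∀ α β → lift (α ∘ˢ β) ≈ˢ lift α ∘ˢ lift β
  lift-∘ α β p = vertex-cong
    (cong (perm α ⟨$⟩ʳ_) (sym (shape-vertex {n} _ _)))
    (λ y → cong (_xor false) (trans
      (sym (xor-identityʳ (phase {n} p (perm β ⟨$⟩ˡ (perm α ⟨$⟩ˡ y)))))
      (sym (phase-vertex {n} _ (λ y′ → phase {n} p (perm β ⟨$⟩ˡ y′) xor false) (perm α ⟨$⟩ˡ y)))))

-- Finiteness of the automorphism group

module _ {n} {R : TripleMap (Fin n)} where

  -- A symmetry is found at the codes of its permutation and of the inverse; pairs of codes
  -- describing no symmetry default to the identity.
  symmetries : ∃[ L ] ∀ (α : Symmetry R) → Any (α ≈ˢ_) L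
  symmetries = cartesianProductWith symmetry (allFin (n ^ n)) (allFin (n ^ n)) ,
    λ α → lose
      (∈-cartesianProductWith⁺ symmetry
        (∈-allFin (code (perm α))) (∈-allFin (code (flip (perm α)))))
      (symmetry-code α)
    where
    IsSymmetry : (Fin n → Fin n) → (Fin n → Fin n) → Set
    IsSymmetry f g = (∀ x → f (g x) ≡ x) × (∀ x → g (f x) ≡ x) ×
                     (∀ x y z → R (f x) (f y) (f z) ≡ R x y z)

    isSymmetry? : ∀ f g → Dec (IsSymmetry f g)
    isSymmetry? f g =
      all? (λ x → f (g x) ≟ x) ×-dec all? (λ x → g (f x) ≟ x) ×-dec
      all? (λ x → all? λ y → all? λ z → R (f x) (f y) (f z) ≟ᵇ R x y z)

    fromDec : ∀ {f g} → Dec (IsSymmetry f g) → Symmetry R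
    fromDec {f} {g} (yes (fg , gf , pres)) =
      record { perm = permutation f g fg gf ; preserves = pres }
    fromDec (no _) = idˢ

    symmetry : Fin (n ^ n) → Fin (n ^ n) → Symmetry R
    symmetry c d = fromDec (isSymmetry? (finToFun c) (finToFun d))

    code : Permutation′ n → Fin (n ^ n)
    code π = funToFin (π ⟨$⟩ʳ_)

    symmetry-code : ∀ α → α ≈ˢ symmetry (code (perm α)) (code (flip (perm α)))
    symmetry-code α x with isSymmetry? (finToFun (code (perm α))) (finToFun (code (flip (perm α))))
    ... | yes _ = sym (finToFun-funToFin (perm α ⟨$⟩ʳ_) x)
    ... | no ¬s = ⊥-elim (¬s
      ( (λ x → trans (f≗ _) (trans (cong (perm α ⟨$⟩ʳ_) (g≗ x)) (inverseʳ (perm α))))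
      , (λ x → trans (g≗ _) (trans (cong (perm α ⟨$⟩ˡ_) (f≗ x)) (inverseˡ (perm α))))
      , (λ x y z → trans (cong₃ R (f≗ x) (f≗ y) (f≗ z)) (preserves α x y z))))
      where
      f≗ = finToFun-funToFin (perm α ⟨$⟩ʳ_)
      g≗ = finToFun-funToFin (perm α ⟨$⟩ˡ_)

-- Extending partial automorphisms to the cover

transpose-hit : ∀ {n} (i j : Fin n) → transpose i j ⟨$⟩ʳ i ≡ j
transpose-hit i j with i ≟ i
... | yes _  = refl
... | no i≢i = ⊥-elim (i≢i refl)

transpose-fix : ∀ {n} (i j k : Fin n) → (k ≡ j → i ≡ j) → (k ≡ i → i ≡ j) →
                transpose i j ⟨$⟩ʳ k ≡ k
transpose-fix i j k kj ki with k ≟ i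
... | yes k≡i = trans (sym (ki k≡i)) (sym k≡i)
... | no _ with k ≟ j
...   | yes k≡j = trans (kj k≡j) (sym k≡j)
...   | no _    = refl

-- Induction on the length: once the later points are placed, a transposition corrects the first.
-- The hypotheses replace injectivity, so that tuples with repeated entries are allowed.
extendToPermutation : ∀ {n} k (u v : Fin k → Fin n) →
  (∀ i j → u i ≡ u j → v i ≡ v j) → (∀ i j → v i ≡ v j → u i ≡ u j) →
  ∃[ π ] ∀ i → π ⟨$⟩ʳ u i ≡ v i
extendToPermutation zero    u v u⇒v v⇒u = idₚ , λ ()
extendToPermutation (suc k) u v u⇒v v⇒u
  with extendToPermutation k (u ∘ suc) (v ∘ suc)
         (λ i j → u⇒v (suc i) (suc j)) (λ i j → v⇒u (suc i) (suc j))
... | π , π-extends = π ∘ₚ transpose (π ⟨$⟩ʳ u zero) (v zero) , extends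
  where
  extends : ∀ i → transpose (π ⟨$⟩ʳ u zero) (v zero) ⟨$⟩ʳ (π ⟨$⟩ʳ u i) ≡ v i
  extends zero    = transpose-hit (π ⟨$⟩ʳ u zero) (v zero)
  extends (suc i) = trans (transpose-fix _ _ _ merged merged′) (π-extends i)
    where
    merged : π ⟨$⟩ʳ u (suc i) ≡ v zero → π ⟨$⟩ʳ u zero ≡ v zero
    merged eq = trans (cong (π ⟨$⟩ʳ_) (v⇒u zero (suc i) (trans (sym eq) (π-extends i)))) eq

    merged′ : π ⟨$⟩ʳ u (suc i) ≡ π ⟨$⟩ʳ u zero → π ⟨$⟩ʳ u zero ≡ v zero
    merged′ eq = merged (trans (π-extends i) (u⇒v (suc i) zero (begin
      u (suc i)                     ≡⟨ inverseˡ π ⟨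
      π ⟨$⟩ˡ (π ⟨$⟩ʳ u (suc i))     ≡⟨ cong (π ⟨$⟩ˡ_) eq ⟩
      π ⟨$⟩ˡ (π ⟨$⟩ʳ u zero)        ≡⟨ inverseˡ π ⟩
      u zero                        ∎)))

module PartialSymmetry {n} {R : TripleMap (Fin n)} (c : IsCocycle R)
  {k} (u v : Fin (suc k) → Fin n)
  (u⇒v : ∀ i j → u i ≡ u j → v i ≡ v j) (v⇒u : ∀ i j → v i ≡ v j → u i ≡ u j)
  (matches : ∀ i j l → R (v i) (v j) (v l) ≡ R (u i) (u j) (u l))
  where

  π : Permutation′ n
  π = proj₁ (extendToPermutation (suc k) u v u⇒v v⇒u)

  π-extends : ∀ i → π ⟨$⟩ʳ u i ≡ v i
  π-extends = proj₂ (extendToPermutation (suc k) u v u⇒v v⇒u)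

  R∘π : TripleMap (Fin n)
  R∘π x y z = R (π ⟨$⟩ʳ x) (π ⟨$⟩ʳ y) (π ⟨$⟩ʳ z)

  R∘π-isCocycle : IsCocycle R∘π
  R∘π-isCocycle = pullback-isCocycle (π ⟨$⟩ʳ_) c

  -- A 1-cochain bounding the discrepancy R + R∘π which vanishes on the domain of
  -- the partial map, because its base point is taken there.
  defect : Fin n → Fin n → Bool
  defect x y = R (u zero) x y xor R∘π (u zero) x y

  defect-sym : ∀ x y → defect x y ≡ defect y x
  defect-sym x y = cong₂ _xor_ (swap₂₃ c _ x y) (swap₂₃ R∘π-isCocycle _ x y)

  defect-irrefl : ∀ x → defect x x ≡ false
  defect-irrefl x = cong₂ _xor_ (repeat₂₃ c x _) (repeat₂₃ R∘π-isCocycle x _)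

  defect-u : ∀ i j → defect (u i) (u j) ≡ false
  defect-u i j = trans
    (cong (R (u zero) (u i) (u j) xor_)
      (trans (cong₃ R (π-extends zero) (π-extends i) (π-extends j)) (matches zero i j)))
    (xor-same (R (u zero) (u i) (u j)))

  -- By the cocycle identity `R` and `R∘π` are the coboundaries of their links at `u zero`, so their
  -- sum is the coboundary of the sum of the links.
  δ-defect : ∀ x y z → R∘π x y z ≡ R x y z xor δ defect x y z
  δ-defect x y z = trans (cocycle R∘π-isCocycle (u zero) x y z)
    (trans
      (solve 6 (λ a b e a′ b′ e′ →
          a′ :+ (b′ :+ e′) :=
          (a :+ (b :+ e)) :+ ((a :+ a′) :+ ((b :+ b′) :+ (e :+ e′))))
        refl (R d x y) (R d x z) (R d y z) (R∘π d x y) (R∘π d x z) (R∘π d y z))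
      (cong (_xor δ defect x y z) (sym (cocycle c d x y z))))
    where d = u zero

  domain? : ∀ x → Dec (∃[ i ] u i ≡ x)
  domain? x = any? (λ i → u i ≟ x)

  -- If exactly one argument is in the domain, the outside one carries the defect; if neither is,
  -- the larger one does.
  orient : {A B C : Set} → Dec A → Dec B → Dec C → Bool → Bool
  orient (yes _) _       _       b = false
  orient (no _)  (yes _) _       b = b
  orient (no _)  (no _)  (yes _) b = b
  orient (no _)  (no _)  (no _)  b = false

  -- Splits the symmetric function defect into an asymmetric one that vanishes
  -- whenever its first argument is in the domain.
  half : Fin n → Fin n → Bool
  half x y = orient (domain? x) (domain? y) (y <? x) (defect x y)

  -- Exactly one of the two orders carries the defect, except for two domain points or a repeated
  -- point, where the defect vanishes.
  half-sum : ∀ x y → half x y xor half y x ≡ defect x y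
  half-sum x y with domain? x | domain? y
  ... | yes (i , refl) | yes (j , refl) = sym (defect-u i j)
  ... | yes _          | no _           = defect-sym y x
  ... | no _           | yes _          = xor-identityʳ (defect x y)
  ... | no _           | no _ with y <? x | x <? y | <-cmp x y
  ...   | yes _   | no _    | _               = xor-identityʳ (defect x y)
  ...   | no _    | yes _   | _               = defect-sym y x
  ...   | yes y<x | yes x<y | _               = ⊥-elim (ℕₚ.<-asym x<y y<x)
  ...   | no _    | no x≮y  | tri< x<y _ _    = ⊥-elim (x≮y x<y)
  ...   | no _    | no _    | tri≈ _ refl _   = sym (defect-irrefl x)
  ...   | no y≮x  | no _    | tri> _ _ y<x    = ⊥-elim (y≮x y<x)

  half-u : ∀ i y → half (u i) y ≡ false
  half-u i y with domain? (u i)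
  ... | yes _  = refl
  ... | no ∉u  = ⊥-elim (∉u (i , refl))

  extension : Symmetry (coverEdge R)
  extension = record
    { perm      = twist π half
    ; preserves = twist-preserves R π half (λ x y z → trans (δ-defect x y z)
        (cong (R x y z xor_) (sym
          (cong₂ _xor_ (half-sum x y) (cong₂ _xor_ (half-sum x z) (half-sum y z))))))
    }

  extension-ι : ∀ i → perm extension ⟨$⟩ʳ ι (u i) ≡ ι (v i)
  extension-ι i = trans (twist-ι π half (u i) (half-u i)) (cong ι (π-extends i))

-- Embedding covers in the Fraïssé limit

-- Permutation invariance moves a single index `zero` to the front, where the second hypothesis
-- applies; a second `zero` makes both sides vanish.
agree-on-cons : {V W : Set} {R : TripleMap V} {S : TripleMap W} → IsCocycle R → IsCocycle S →
  ∀ {k} (u : Fin (suc k) → V) (w : Fin (suc k) → W) →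
  (∀ i j l → R (u (suc i)) (u (suc j)) (u (suc l)) ≡ S (w (suc i)) (w (suc j)) (w (suc l))) →
  (∀ i j → R (u zero) (u (suc i)) (u (suc j)) ≡ S (w zero) (w (suc i)) (w (suc j))) →
  ∀ i j l → R (u i) (u j) (u l) ≡ S (w i) (w j) (w l)
agree-on-cons c d u w tail head (suc i) (suc j) (suc l) = tail i j l
agree-on-cons c d u w tail head zero (suc j) (suc l) = head j l
agree-on-cons c d u w tail head (suc i) zero (suc l) =
  trans (swap₁₂ c _ _ _) (trans (head i l) (swap₁₂ d _ _ _))
agree-on-cons c d u w tail head (suc i) (suc j) zero =
  trans (swap₂₃ c _ _ _)
    (trans (agree-on-cons c d u w tail head (suc i) zero (suc j)) (swap₂₃ d _ _ _))
agree-on-cons c d u w tail head zero zero l =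
  trans (repeat c _ _) (sym (repeat d _ _))
agree-on-cons c d u w tail head zero (suc j) zero =
  trans (repeat₁₃ c _ _) (sym (repeat₁₃ d _ _))
agree-on-cons c d u w tail head (suc i) zero zero =
  trans (repeat₂₃ c _ _) (sym (repeat₂₃ d _ _))

bounded : ∀ {k} (f : Fin k → ℕ) → ∃[ N ] ∀ i → f i < N
bounded {zero}  f = zero , λ ()
bounded {suc k} f with bounded (f ∘ suc)
... | N , f<N = suc (f zero) ⊔ N , λ
  { zero    → ℕₚ.m≤m⊔n (suc (f zero)) N
  ; (suc i) → ≤-trans (f<N i) (ℕₚ.m≤n⊔m (suc (f zero)) N)
  }

module _ (T : CountableTwoGraph) (lim : IsFraisseLimit T) where
  open CountableTwoGraph T

  E-isCocycle : IsCocycle E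
  E-isCocycle = isTwoGraph⇒isCocycle isTwoGr

  to-injective : (g : Aut T) → Injective _≡_ _≡_ (to g)
  to-injective g {x} {y} eq = trans (sym (from-to g x)) (trans (cong (from g) eq) (from-to g y))

  -- Universality gives some copy of `R`, and homogeneity moves the part of it indexed by `u` onto
  -- `w`.
  embedOver : ∀ {m k} {R : TripleMap (Fin m)} → IsCocycle R →
    (u : Fin k → Fin m) (w : Fin k → ℕ) → Injective _≡_ _≡_ u → Injective _≡_ _≡_ w →
    (∀ i j l → R (u i) (u j) (u l) ≡ E (w i) (w j) (w l)) →
    ∃[ b ] (Injective _≡_ _≡_ b × (∀ p q r → E (b p) (b q) (b r) ≡ R p q r) ×
            (∀ i → b (u i) ≡ w i))
  embedOver {m} {k} {R} c u w u-inj w-inj agree =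
    let G = record { edge = R ; isTwoGr = isCocycle⇒isTwoGraph c }
        f , f-inj , f-emb = proj₁ lim m G
        g , g-extends = proj₂ lim k (f ∘ u) w (u-inj ∘ f-inj) w-inj
          (λ i j l → trans (f-emb (u i) (u j) (u l)) (agree i j l))
    in to g ∘ f , f-inj ∘ to-injective g ,
       (λ p q r → trans (pres g (f p) (f q) (f r)) (f-emb p q r)) , g-extends

  record Stage : Set where
    field
      size         : ℕ
      point        : Fin size → ℕ
      pt-injective : Injective _≡_ _≡_ point
      base         : Fin size

    edges : TripleMap (Fin size)
    edges x y z = E (point x) (point y) (point z)

    edges-isCocycle : IsCocycle edges
    edges-isCocycle = pullback-isCocycle point E-isCocycle

  open Stage

  record CoverEmbedding (S : Stage) (t : ℕ) : Set where
    field
      embed     : Fin (coverSize (size S)) → ℕ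
      injective : Injective _≡_ _≡_ embed
      isEmb     : ∀ p q r → E (embed p) (embed q) (embed r) ≡ coverEdge (edges S) p q r
      extends   : ∀ x → embed (ι x) ≡ point S x
      hits      : ∃[ p ] embed p ≡ t

  module NewPoint (S : Stage) (t : ℕ) (t∉S : ¬ (∃[ x ] point S x ≡ t)) where
    x₀ = base S

    -- A cover vertex of shape `x₀` and phase `type` forms with `ι x`, `ι y` the value
    -- `R x₀ x y + type x + type y`. Taking for `type` the link of `t` at `x₀`, up to a constant
    -- that cancels, turns this into the cocycle identity at `t`.
    type : Fin (size S) → Bool
    type y = not (E t (point S x₀) (point S y))

    v : Fin (coverSize (size S))
    v = vertex x₀ type

    u : Fin (suc (size S)) → Fin (coverSize (size S))
    u zero    = v
    u (suc x) = ι x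

    w : Fin (suc (size S)) → ℕ
    w zero    = t
    w (suc x) = point S x

    -- The constant added to the type keeps v apart from ι x₀ even when t is a twin of x₀.
    v≢ι : ∀ x → v ≢ ι x
    v≢ι x eq = true≢false (begin
      true             ≡⟨ cong not (repeat₂₃ E-isCocycle _ t) ⟨
      type x₀          ≡⟨ phase-vertex x₀ type x₀ ⟨
      phase v x₀       ≡⟨ cong (λ p → phase p x₀) eq ⟩
      phase (ι x) x₀   ≡⟨ phase-vertex x _ x₀ ⟩
      false            ∎)
      where
      true≢false : true ≢ false
      true≢false ()

    u-inj : Injective _≡_ _≡_ u
    u-inj {zero}  {zero}  _  = refl
    u-inj {zero}  {suc x} eq = ⊥-elim (v≢ι x eq)
    u-inj {suc x} {zero}  eq = ⊥-elim (v≢ι x (sym eq))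
    u-inj {suc x} {suc y} eq = cong suc (ι-injective eq)

    w-inj : Injective _≡_ _≡_ w
    w-inj {zero}  {zero}  _  = refl
    w-inj {zero}  {suc x} eq = ⊥-elim (t∉S (x , sym eq))
    w-inj {suc x} {zero}  eq = ⊥-elim (t∉S (x , eq))
    w-inj {suc x} {suc y} eq = cong suc (pt-injective S eq)

    realises : ∀ x y → coverEdge (edges S) v (ι x) (ι y) ≡ E t (point S x) (point S y)
    realises x y = begin
      coverEdge (edges S) v (ι x) (ι y)
        ≡⟨ coverEdge-vertex (edges S) x₀ type x _ y _ ⟩
      edges S x₀ x y xor ((type x xor false) xor ((type y xor false) xor false))
        ≡⟨ cong (_xor ((type x xor false) xor ((type y xor false) xor false)))
             (cocycle E-isCocycle t (point S x₀) (point S x) (point S y)) ⟩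
      (a xor (b xor e)) xor ((not a xor false) xor ((not b xor false) xor false))
        ≡⟨ solve 3 (λ a b e →
               (a :+ (b :+ e)) :+
               (((con true :+ a) :+ con false) :+
                (((con true :+ b) :+ con false) :+ con false)) := e)
             refl a b e ⟩
      e ∎
      where
      a = E t (point S x₀) (point S x)
      b = E t (point S x₀) (point S y)
      e = E t (point S x) (point S y)
    coverEmbedding-new : CoverEmbedding S t
    coverEmbedding-new =
      let c = coverEdge-isCocycle (edges-isCocycle S)
          b , b-inj , b-emb , b-ext = embedOver c u w u-inj w-inj
            (agree-on-cons c E-isCocycle u w (coverEdge-ι (edges S)) realises)
      in record
        { embed = b ; injective = b-inj ; isEmb = b-emb ; extends = b-ext ∘ suc
        ; hits = v , b-ext zero }

  coverEmbedding-old : ∀ S x → CoverEmbedding S (point S x)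
  coverEmbedding-old S x =
    let b , b-inj , b-emb , b-ext =
          embedOver (coverEdge-isCocycle (edges-isCocycle S)) ι (point S)
            ι-injective (pt-injective S) (coverEdge-ι (edges S))
    in record
      { embed = b ; injective = b-inj ; isEmb = b-emb ; extends = b-ext ; hits = ι x , b-ext x }

  abstract
    coverEmbedding : ∀ S t → CoverEmbedding S t
    coverEmbedding S t with any? (λ x → point S x ℕₚ.≟ t)
    ... | yes (x , refl) = coverEmbedding-old S x
    ... | no t∉S         = NewPoint.coverEmbedding-new S t t∉S

  next : Stage → ℕ → Stage
  next S t = record
    { size         = coverSize (size S)
    ; point        = CoverEmbedding.embed (coverEmbedding S t)
    ; pt-injective = CoverEmbedding.injective (coverEmbedding S t)
    ; base         = ι (base S)
    }

  -- A chain of iterated covers exhausting the limit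

  stage : ℕ → Stage
  stage zero    = record
    { size = 1 ; point = λ _ → 0 ; pt-injective = λ { {zero} {zero} _ → refl } ; base = zero }
  -- Stage `suc m` takes in the vertex `m`, so stage `m` contains every vertex below `m`.
  stage (suc m) = next (stage m) m

  pt : ∀ m → Fin (size (stage m)) → ℕ
  pt m = point (stage m)

  pt-ι : ∀ m x → pt (suc m) (ι x) ≡ pt m x
  pt-ι m = CoverEmbedding.extends (coverEmbedding (stage m) m)

  StageSymmetry : ℕ → Set
  StageSymmetry m = Symmetry (edges (stage m))

  act : ∀ m → StageSymmetry m → Fin (size (stage m)) → Fin (size (stage m))
  act m α = perm α ⟨$⟩ʳ_

  -- The hyperedges of the next stage agree with those of the cover only propositionally, through
  -- `isEmb`, so the preservation proof has to be transported.
  fromCover : ∀ m → Symmetry (coverEdge (edges (stage m))) → StageSymmetry (suc m)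
  fromCover m α = record
    { perm      = perm α
    ; preserves = λ p q r → trans (isEmb _ _ _) (trans (preserves α p q r) (sym (isEmb p q r)))
    }
    where open CoverEmbedding (coverEmbedding (stage m) m)

  up : ∀ m → StageSymmetry m → StageSymmetry (suc m)
  up m α = fromCover m (lift α)

  covered : ∀ m t → t < m → ∃[ x ] pt m x ≡ t
  covered (suc m) t t<1+m with ℕₚ.m<1+n⇒m<n∨m≡n t<1+m
  ... | inj₂ refl = CoverEmbedding.hits (coverEmbedding (stage m) m)
  ... | inj₁ t<m with covered m t t<m
  ...   | x , x↦t = ι x , trans (pt-ι m x) x↦t

  -- Coherent families and the automorphisms they induce

  Family : Set
  Family = ∀ m → StageSymmetry m

  -- The threshold `j` is there because a symmetry of stage `j` need not restrict to earlier stages.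
  Coherent : ℕ → Family → Set
  Coherent j α = ∀ m → j ≤ m → α (suc m) ≈ˢ up m (α m)

  Realises : ℕ → Family → Aut T → Set
  Realises j α g = ∀ m → j ≤ m → ∀ x → to g (pt m x) ≡ pt m (act m (α m) x)

  invᶠ : Family → Family
  invᶠ α m = invˢ (α m)

  coherent-inv : ∀ {j} α → Coherent j α → Coherent j (invᶠ α)
  coherent-inv α coh m j≤m = invˢ-cong {α = α (suc m)} {β = up m (α m)} (coh m j≤m)

  coherent-id : ∀ {j} → Coherent j (λ _ → idˢ)
  coherent-id m _ p = sym (lift-id {R = edges (stage m)} p)

  coherent-∘ : ∀ {j} α β → Coherent j α → Coherent j β → Coherent j (λ m → α m ∘ˢ β m)
  coherent-∘ α β cohα cohβ m j≤m p = begin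
    act (suc m) (α (suc m)) (act (suc m) (β (suc m)) p)
      ≡⟨ cohα m j≤m _ ⟩
    act (suc m) (up m (α m)) (act (suc m) (β (suc m)) p)
      ≡⟨ cong (act (suc m) (up m (α m))) (cohβ m j≤m p) ⟩
    act (suc m) (up m (α m)) (act (suc m) (up m (β m)) p)
      ≡⟨ lift-∘ (α m) (β m) p ⟨
    act (suc m) (up m (α m ∘ˢ β m)) p ∎

  -- The action of one stage on the vertices of `T`, as a relation because only finitely many
  -- vertices have an index there.
  Maps : Family → ℕ → ℕ → ℕ → Set
  Maps α m t s = ∃[ x ] (pt m x ≡ t × pt m (act m (α m) x) ≡ s)

  maps-inv : ∀ α m {t s} → Maps α m t s → Maps (invᶠ α) m s t
  maps-inv α m (x , x↦t , αx↦s) =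
    act m (α m) x , αx↦s , trans (cong (pt m) (inverseˡ (perm (α m)))) x↦t

  maps-inv⁻¹ : ∀ α m {t s} → Maps (invᶠ α) m t s → Maps α m s t
  maps-inv⁻¹ α m (x , x↦t , αx↦s) =
    perm (α m) ⟨$⟩ˡ x , αx↦s , trans (cong (pt m) (inverseʳ (perm (α m)))) x↦t

  module _ {j} (α : Family) (coh : Coherent j α) where

    maps-suc : ∀ {m t s} → j ≤ m → Maps α m t s → Maps α (suc m) t s
    maps-suc {m} j≤m (x , x↦t , αx↦s) = ι x , trans (pt-ι m x) x↦t , (begin
      pt (suc m) (act (suc m) (α (suc m)) (ι x))  ≡⟨ cong (pt (suc m)) (coh m j≤m (ι x)) ⟩
      pt (suc m) (act (suc m) (up m (α m)) (ι x)) ≡⟨ cong (pt (suc m)) (lift-ι (α m) x) ⟩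
      pt (suc m) (ι (act m (α m) x))              ≡⟨ pt-ι m _ ⟩
      pt m (act m (α m) x)                        ≡⟨ αx↦s ⟩
      _                                           ∎)

    maps-+ : ∀ d {m t s} → j ≤ m → Maps α m t s → Maps α (d + m) t s
    maps-+ zero    j≤m r = r
    maps-+ (suc d) j≤m r = maps-suc (≤-trans j≤m (ℕₚ.m≤n+m _ d)) (maps-+ d j≤m r)

    -- Both pairs persist to the common stage `m′ + m`, where `t` has a single index.
    maps-functional : ∀ {m m′ t s s′} → j ≤ m → j ≤ m′ →
                      Maps α m t s → Maps α m′ t s′ → s ≡ s′
    maps-functional {m} {m′} {t} {s} {s′} j≤m j≤m′ r r′
      with maps-+ m′ j≤m r | subst (λ k → Maps α k t s′) (ℕₚ.+-comm m m′) (maps-+ m j≤m′ r′)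
    ... | x , x↦t , αx↦s | y , y↦t , αy↦s′ = begin
      s                      ≡⟨ αx↦s ⟨
      pt k (act k (α k) x)   ≡⟨ cong (pt k ∘ act k (α k)) x≡y ⟩
      pt k (act k (α k) y)   ≡⟨ αy↦s′ ⟩
      s′                     ∎
      where
      k = m′ + m
      x≡y = pt-injective (stage k) (trans x↦t (sym y↦t))

    -- Late enough both to contain `t` and to lie in the coherent range.
    level : ℕ → ℕ
    level t = suc t + j

    j≤level : ∀ t → j ≤ level t
    j≤level t = ℕₚ.m≤n+m j (suc t)

    value : ℕ → ℕ
    value t = pt (level t) (act (level t) (α (level t))
      (proj₁ (covered (level t) t (ℕₚ.m≤m+n (suc t) j))))

    maps-value : ∀ t → Maps α (level t) t (value t)
    maps-value t = _ , proj₂ (covered (level t) t (ℕₚ.m≤m+n (suc t) j)) , refl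

    value-pt : ∀ m → j ≤ m → ∀ x → value (pt m x) ≡ pt m (act m (α m) x)
    value-pt m j≤m x =
      maps-functional (j≤level (pt m x)) j≤m (maps-value (pt m x)) (x , refl , refl)

  common-level : ∀ j x y z → ∃[ m ]
    (j ≤ m × (∃[ p ] pt m p ≡ x) × (∃[ q ] pt m q ≡ y) × (∃[ r ] pt m r ≡ z))
  common-level j x y z =
    m , ℕₚ.m≤n+m j _
    , covered m x (≤-trans (ℕₚ.m≤m+n _ _) (≤-trans (ℕₚ.m≤m+n _ _) (ℕₚ.m≤m+n _ j)))
    , covered m y (≤-trans (ℕₚ.m≤n+m _ (suc x)) (≤-trans (ℕₚ.m≤m+n _ _) (ℕₚ.m≤m+n _ j)))
    , covered m z (≤-trans (ℕₚ.m≤n+m _ (suc x + suc y)) (ℕₚ.m≤m+n _ j))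
    where m = suc x + suc y + suc z + j

  -- The inverse family is coherent too and induces the inverse map, by functionality of `Maps`.
  -- Preservation is checked at one stage containing all three vertices.
  realise : ∀ {j} α → Coherent j α → ∃[ g ] Realises j α g
  realise {j} α coh = g , value-pt α coh
    where
    coh⁻¹ : Coherent j (invᶠ α)
    coh⁻¹ = coherent-inv α coh

    g : Aut T
    g = record
      { to      = value α coh
      ; from    = value (invᶠ α) coh⁻¹
      ; to-from = λ s → maps-functional α coh (j≤level α coh _) (j≤level (invᶠ α) coh⁻¹ s)
          (maps-value α coh _) (maps-inv⁻¹ α (level (invᶠ α) coh⁻¹ s) (maps-value (invᶠ α) coh⁻¹ s))
      ; from-to = λ t → maps-functional (invᶠ α) coh⁻¹ (j≤level (invᶠ α) coh⁻¹ _) (j≤level α coh t)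
          (maps-value (invᶠ α) coh⁻¹ _) (maps-inv α (level α coh t) (maps-value α coh t))
      ; pres    = preserved
      }
      where
      preserved : ∀ x y z → E (value α coh x) (value α coh y) (value α coh z) ≡ E x y z
      preserved x y z with common-level j x y z
      ... | m , j≤m , (p , refl) , (q , refl) , (r , refl) = trans
        (cong₃ E (value-pt α coh m j≤m p) (value-pt α coh m j≤m q) (value-pt α coh m j≤m r))
        (preserves (α m) p q r)

  -- A coherent family from stage j on is determined by its member at stage j;
  -- earlier members are junk.
  generate : ∀ j → StageSymmetry j → Family
  generate j β m with m ℕₚ.≟ j
  generate j β m       | yes refl = β
  generate j β zero    | no _     = idˢ
  generate j β (suc m) | no _     = up m (generate j β m)

  generate-coherent : ∀ j β → Coherent j (generate j β)
  generate-coherent j β m j≤m p with suc m ℕₚ.≟ j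
  ... | yes refl = ⊥-elim (ℕₚ.<-irrefl refl j≤m)
  ... | no _     = refl

  generate-base : ∀ j β → generate j β j ≡ β
  generate-base j β rewrite ℕₚ.≟-diag (refl {x = j}) = refl

  coherent-unique : ∀ {j} α β → Coherent j α → Coherent j β → α j ≈ˢ β j →
                    ∀ d → α (d + j) ≈ˢ β (d + j)
  coherent-unique α β cohα cohβ eq zero = eq
  coherent-unique {j} α β cohα cohβ eq (suc d) p = begin
    act (suc d + j) (α (suc d + j)) p
      ≡⟨ cohα (d + j) (ℕₚ.m≤n+m j d) p ⟩
    act (suc d + j) (up (d + j) (α (d + j))) p
      ≡⟨ lift-cong {α = α (d + j)} {β (d + j)} (coherent-unique α β cohα cohβ eq d) p ⟩
    act (suc d + j) (up (d + j) (β (d + j))) p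
      ≡⟨ cohβ (d + j) (ℕₚ.m≤n+m j d) p ⟨
    act (suc d + j) (β (suc d + j)) p ∎

  -- The direct limit of the stage groups and its local finiteness

  -- For fixed `j` this is a copy, up to pointwise equality, of the finite symmetry group of stage
  -- `j`; these groups increase with `j`.
  CoherentFrom : ℕ → Aut T → Set
  CoherentFrom j g = ∃[ α ] (Coherent j α × Realises j α g)

  coherentFrom-mono : ∀ {j k g} → j ≤ k → CoherentFrom j g → CoherentFrom k g
  coherentFrom-mono j≤k (α , coh , real) =
    α , (λ m k≤m → coh m (≤-trans j≤k k≤m)) , (λ m k≤m → real m (≤-trans j≤k k≤m))

  coherentFrom-resp : ∀ {j g h} → _≈ᴬ_ T g h → CoherentFrom j g → CoherentFrom j h
  coherentFrom-resp g≈h (α , coh , real) =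
    α , coh , λ m j≤m x → trans (sym (g≈h (pt m x))) (real m j≤m x)

  coherentFrom-id : ∀ {j} → CoherentFrom j (idᴬ T)
  coherentFrom-id = (λ _ → idˢ) , coherent-id , λ _ _ _ → refl

  coherentFrom-∘ : ∀ {j g h} → CoherentFrom j g → CoherentFrom j h → CoherentFrom j (_∘ᴬ_ T g h)
  coherentFrom-∘ {g = g} (α , cohα , realα) (β , cohβ , realβ) =
    (λ m → α m ∘ˢ β m) , coherent-∘ α β cohα cohβ ,
    λ m j≤m x → trans (cong (to g) (realβ m j≤m x)) (realα m j≤m _)

  coherentFrom-inv : ∀ {j g} → CoherentFrom j g → CoherentFrom j (invᴬ T g)
  coherentFrom-inv {g = g} (α , coh , real) = invᶠ α , coherent-inv α coh , λ m j≤m x → begin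
    from g (pt m x)
      ≡⟨ cong (from g ∘ pt m) (inverseʳ (perm (α m))) ⟨
    from g (pt m (act m (α m) (perm (α m) ⟨$⟩ˡ x)))
      ≡⟨ cong (from g) (real m j≤m _) ⟨
    from g (to g (pt m (perm (α m) ⟨$⟩ˡ x)))
      ≡⟨ from-to g _ ⟩
    pt m (perm (α m) ⟨$⟩ˡ x) ∎

  H : Aut T → Set
  H g = ∃[ j ] CoherentFrom j g

  H-isSubgroup : IsSubgroup T H
  H-isSubgroup = record
    { resp     = λ { {g} {h} g≈h (j , c) → j , coherentFrom-resp {g = g} {h} g≈h c }
    ; has-id   = 0 , coherentFrom-id
    ; has-comp = λ { {g} {h} (j , c) (k , d) → j ⊔ k ,
        coherentFrom-∘ {g = g} {h} (coherentFrom-mono {g = g} (ℕₚ.m≤m⊔n j k) c)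
                                   (coherentFrom-mono {g = h} (ℕₚ.m≤n⊔m j k) d) }
    ; has-inv  = λ { {g} (j , c) → j , coherentFrom-inv {g = g} c }
    }

  uniform : ∀ gs → All H gs → ∃[ j ] All (CoherentFrom j) gs
  uniform []       []             = 0 , []
  uniform (g ∷ gs) ((j , c) ∷ hs) with uniform gs hs
  ... | k , cs = j ⊔ k , coherentFrom-mono {g = g} (ℕₚ.m≤m⊔n j k) c
                       ∷ All.map (λ {h} → coherentFrom-mono {g = h} (ℕₚ.m≤n⊔m j k)) cs

  generated⊆ : ∀ {j gs} → All (CoherentFrom j) gs → ∀ {g} → Generated T gs g → CoherentFrom j g
  generated⊆ cs (gen g∈gs) = All.lookup cs g∈gs
  generated⊆ cs gid = coherentFrom-id
  generated⊆ cs (gcomp {g} {h} gg gh) =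
    coherentFrom-∘ {g = g} {h} (generated⊆ cs gg) (generated⊆ cs gh)
  generated⊆ cs (ginv {g} gg) = coherentFrom-inv {g = g} (generated⊆ cs gg)

  realiser : ∀ j → StageSymmetry j → Aut T
  realiser j β = proj₁ (realise (generate j β) (generate-coherent j β))

  realiser-realises : ∀ j (β : StageSymmetry j) → Realises j (generate j β) (realiser j β)
  realiser-realises j β = proj₂ (realise (generate j β) (generate-coherent j β))

  -- The member at stage `j` determines all later ones, and the later stages contain every vertex.
  realiser-unique : ∀ j {g} (c : CoherentFrom j g) (β : StageSymmetry j) → proj₁ c j ≈ˢ β →
                    _≈ᴬ_ T g (realiser j β)
  realiser-unique j {g} (α , coh , real) β α≈β t = begin
    to g t                           ≡⟨ cong (to g) x↦t ⟨
    to g (pt m x)                    ≡⟨ real m j≤m x ⟩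
    pt m (act m (α m) x)             ≡⟨ cong (pt m) (agree (suc t) x) ⟩
    pt m (act m (generate j β m) x)  ≡⟨ realiser-realises j β m j≤m x ⟨
    to (realiser j β) (pt m x)       ≡⟨ cong (to (realiser j β)) x↦t ⟩
    to (realiser j β) t              ∎
    where
    m = suc t + j
    j≤m = ℕₚ.m≤n+m j (suc t)
    x = proj₁ (covered m t (ℕₚ.m≤m+n (suc t) j))
    x↦t = proj₂ (covered m t (ℕₚ.m≤m+n (suc t) j))
    agree : ∀ d → α (d + j) ≈ˢ generate j β (d + j)
    agree = coherent-unique α (generate j β) coh (generate-coherent j β)
      (λ y → trans (α≈β y) (cong (λ γ → act j γ y) (sym (generate-base j β))))

  coherentFrom-finite : ∀ j → FiniteSubgroup T (CoherentFrom j)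
  coherentFrom-finite j = map (realiser j) (proj₁ symmetries) , λ g c →
    map⁺ (Any.map (λ {β} → realiser-unique j {g} c β) (proj₂ symmetries (proj₁ c j)))

  -- Finitely many generators lie in one group of the increasing union, hence so does all that they
  -- generate, and that group is finite.
  H-locallyFinite : LocallyFinite T H
  H-locallyFinite gs hs with uniform gs hs
  ... | j , cs = proj₁ (coherentFrom-finite j) ,
                 λ g gg → proj₂ (coherentFrom-finite j) g (generated⊆ cs gg)

  -- Density

  -- On a stage containing the tuple and its image, `g` gives a partial symmetry. It extends to a
  -- symmetry of the next stage, which generates a coherent family agreeing with `g` on the tuple.
  H-dense : Dense T H
  H-dense g n a = h , (N⁺ , generate N⁺ θ , generate-coherent N⁺ θ , h-realises) , λ i → begin
    to h (a i)                    ≡⟨ cong (to h) (u↦ (suc i)) ⟨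
    to h (pt N (u (suc i)))       ≡⟨ cong (to h) (pt-ι N _) ⟨
    to h (pt N⁺ (ι (u (suc i))))  ≡⟨ h-realises N⁺ ≤-refl _ ⟩
    pt N⁺ (act N⁺ (generate N⁺ θ N⁺) (ι (u (suc i))))
      ≡⟨ cong (λ γ → pt N⁺ (act N⁺ γ (ι (u (suc i))))) (generate-base N⁺ θ) ⟩
    pt N⁺ (act N⁺ θ (ι (u (suc i))))
      ≡⟨ cong (pt N⁺) (P.extension-ι (suc i)) ⟩
    pt N⁺ (ι (v (suc i)))         ≡⟨ pt-ι N _ ⟩
    pt N (v (suc i))              ≡⟨ v↦ (suc i) ⟩
    to g (a i)                    ∎
    where
    -- The defect of a partial map needs a base point in its domain.
    a⁺ : Fin (suc n) → ℕ
    a⁺ zero    = 0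
    a⁺ (suc i) = a i

    -- A bound for the tuple and for its image, so that stage `N` contains both.
    N = proj₁ (bounded a⁺) ⊔ proj₁ (bounded (to g ∘ a⁺))
    N⁺ = suc N

    u-covered : ∀ i → ∃[ x ] pt N x ≡ a⁺ i
    u-covered i = covered N (a⁺ i) (≤-trans (proj₂ (bounded a⁺) i) (ℕₚ.m≤m⊔n _ _))

    v-covered : ∀ i → ∃[ x ] pt N x ≡ to g (a⁺ i)
    v-covered i = covered N (to g (a⁺ i))
      (≤-trans (proj₂ (bounded (to g ∘ a⁺)) i) (ℕₚ.m≤n⊔m (proj₁ (bounded a⁺)) _))

    u v : Fin (suc n) → Fin (size (stage N))
    u i = proj₁ (u-covered i)
    v i = proj₁ (v-covered i)

    u↦ : ∀ i → pt N (u i) ≡ a⁺ i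
    u↦ i = proj₂ (u-covered i)

    v↦ : ∀ i → pt N (v i) ≡ to g (a⁺ i)
    v↦ i = proj₂ (v-covered i)

    v↦g : ∀ i → pt N (v i) ≡ to g (pt N (u i))
    v↦g i = trans (v↦ i) (cong (to g) (sym (u↦ i)))

    -- As `g` is a bijection, `u` and `v` identify the same indices even when `a` has repeated
    -- entries.
    module P = PartialSymmetry (edges-isCocycle (stage N)) u v
      (λ i j eq → pt-injective (stage N)
        (trans (v↦g i) (trans (cong (to g ∘ pt N) eq) (sym (v↦g j)))))
      (λ i j eq → pt-injective (stage N) (to-injective g
        (trans (sym (v↦g i)) (trans (cong (pt N) eq) (v↦g j)))))
      (λ i j l → trans (cong₃ E (v↦g i) (v↦g j) (v↦g l)) (pres g _ _ _))

    θ : StageSymmetry N⁺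
    θ = fromCover N P.extension

    h : Aut T
    h = realiser N⁺ θ

    h-realises : Realises N⁺ (generate N⁺ θ) h
    h-realises = realiser-realises N⁺ θ

theorem5p1 : (T : CountableTwoGraph) → IsFraisseLimit T →
    ∃[ H ] (IsSubgroup T H × Dense T H × LocallyFinite T H)
theorem5p1 T lim = H T lim , H-isSubgroup T lim , H-dense T lim , H-locallyFinite T lim
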